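{- Let $G$ be a graph, $B$ a standard zero forcing set of $G$, and $\mathcal F$ a relaxed chronology of standard forces for $B$. Then (1) $\operatorname{Term}(\mathcal F)$ is a standard zero forcing set of $G$, (2) $\operatorname{Rev}(\mathcal F)$ is a relaxed chronology of standard forces for $\operatorname{Term}(\mathcal F)$, and (3) $\operatorname{pt}(G,\operatorname{Rev}(\mathcal F))=\operatorname{pt}(G,\mathcal F)$.
   Context: All graphs are finite, simple and undirected. Standard zero forcing: each vertex is blue or white; a blue vertex $u$ with exactly one white neighbor $v$ can force $v$ to become blue (written $u\to v$). A set $B$ of vertices is a standard zero forcing set of $G$ if, starting with exactly $B$ blue, repeated forcing turns all vertices blue. $S(G,B)$ denotes the set of forces valid in $G$ when exactly the vertices of $B$ are blue. Relaxed chronology of standard forces for a standard zero forcing set $B$: an ordered family $\mathcal F=\{F^{(k)}\}_{k=1}^K$ of sets of forces ($F^{(k)}=\emptyset$ allowed) such that, with $E^{[0]}=E^{(0)}=B$, $E^{(k)}=\{u: v\to u\in F^{(k)}\text{ for some }v\}$ and $E^{[k]}=\bigcup_{j=0}^kE^{(j)}$ for $k=1,\dots,K$: (a) $F^{(k)}\subseteq S(G,E^{[k-1]})$ for $k=1,\dots,K$; (b) $v_1\to u,\ v_2\to u\in F^{(k)}$ implies $v_1=v_2$; (c) $E^{[K]}=V(G)$. $\operatorname{Term}(\mathcal F)$, the terminus of $\mathcal F$, is the set of vertices of $G$ that perform no force in $\mathcal F$. $\operatorname{Rev}(\mathcal F)$, the reversal of $\mathcal F$, is $\{F_{\operatorname{Rev}}^{(k)}\}_{k=1}^K$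 with $F_{\operatorname{Rev}}^{(k)}=\{v\to u: u\to v\in F^{(K-k+1)}\}$. The propagation time $\operatorname{pt}(G,\mathcal F)$ is defined from the underlying set of forces $F=\bigcup_kF^{(k)}$ and the initial set $B$: put $D^{(0)}=B$, and for $t\ge0$ let $D^{(t+1)}$ be the set of vertices $w$ such that $v\to w\in F\cap S(G,\bigcup_{i=0}^tD^{(i)})$ for some $v$; then $\operatorname{pt}(G,\mathcal F)$ is the least $t_0$ with $\bigcup_{t=0}^{t_0}D^{(t)}=V(G)$. For $\operatorname{Rev}(\mathcal F)$ the initial set is $\operatorname{Term}(\mathcal F)$. -}

module Defs where

open import Data.Fin using (Fin; zero; suc; inject₁; fromℕ; opposite)
open import Data.Fin.Properties using (_≟_; _≤?_; any?; all?)
open import Data.Fin.Subset using (Subset; _∈_; _∉_; _∪_; ⁅_⁆; ⊤)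
open import Data.Fin.Subset.Properties using (_∈?_)
open import Data.Nat as ℕ using (ℕ; zero; suc)
open import Data.Product using (∃₂; _×_)
open import Data.Vec using (tabulate)
open import Relation.Binary.Construct.Closure.ReflexiveTransitive using (Star)
open import Relation.Binary.Definitions using (Symmetric; Irreflexive)
  renaming (Decidable to Decidable₂)
open import Relation.Binary.PropositionalEquality using (_≡_)
open import Relation.Nullary using (does; ¬?)
open import Relation.Nullary.Decidable using (_×-dec_; _→-dec_)
open import Relation.Unary using (Decidable)

private
  variable
    n K : ℕ

record Graph (n : ℕ) : Set₁ where
  field
    Adj    : Fin n → Fin n → Set
    adj?   : Decidable₂ Adj
    sym    : Symmetric Adj
    irrefl : Irreflexive _≡_ Adj

open Graph public

comprehension : {P : Fin n → Set} → Decidable P → Subset n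
comprehension P? = tabulate (λ v → does (P? v))

-- A set of ordered pairs, stored by source: the force v → u belongs to F
-- when u ∈ F v.
Forces : ℕ → Set
Forces n = Fin n → Subset n

-- ValidForce G X v u says that v → u ∈ S(G, X).
ValidForce : Graph n → Subset n → Fin n → Fin n → Set
ValidForce G X v u =
  v ∈ X × u ∉ X × Adj G v u × (∀ w → Adj G v w → w ∉ X → w ≡ u)

validForce? : (G : Graph n) (X : Subset n) → Decidable₂ (ValidForce G X)
validForce? G X v u =
  v ∈? X ×-dec ¬? (u ∈? X) ×-dec adj? G v u ×-dec
  all? (λ w → adj? G v w →-dec (¬? (w ∈? X) →-dec w ≟ u))

ForceStep : Graph n → Subset n → Subset n → Set
ForceStep G X Y = ∃₂ λ v u → ValidForce G X v u × Y ≡ X ∪ ⁅ u ⁆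

IsZeroForcingSet : Graph n → Subset n → Set
IsZeroForcingSet G B = Star (ForceStep G) B ⊤

-- An ordered family of K sets of forces. The index k : Fin K is zero-based
-- and stands for F⁽ᵏ⁺¹⁾.
ForceFamily : ℕ → ℕ → Set
ForceFamily n K = Fin K → Forces n

-- E⁽ᵏ⁾ and E^[ k ], for k = 0, …, K.
E : Subset n → ForceFamily n K → Fin (suc K) → Subset n
E B 𝓕 zero    = B
E B 𝓕 (suc k) = comprehension (λ u → any? (λ v → u ∈? 𝓕 k v))

E^[_] : Fin (suc K) → Subset n → ForceFamily n K → Subset n
E^[ k ] B 𝓕 = comprehension (λ u → any? (λ j → j ≤? k ×-dec u ∈? E B 𝓕 j))

-- In `valid`, inject₁ k is the index of the set of vertices that are blue
-- just before the forces 𝓕 k are performed.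
record IsRelaxedChronology (G : Graph n) (B : Subset n)
                           (𝓕 : ForceFamily n K) : Set where
  field
    valid        : ∀ k v u → u ∈ 𝓕 k v → ValidForce G (E^[ inject₁ k ] B 𝓕) v u
    uniqueForcer : ∀ k v₁ v₂ u → u ∈ 𝓕 k v₁ → u ∈ 𝓕 k v₂ → v₁ ≡ v₂
    allBlue      : E^[ fromℕ K ] B 𝓕 ≡ ⊤

underlying : ForceFamily n K → Forces n
underlying 𝓕 v = comprehension (λ u → any? (λ k → u ∈? 𝓕 k v))

Term : ForceFamily n K → Subset n
Term 𝓕 = comprehension (λ v → ¬? (any? (λ u → u ∈? underlying 𝓕 v)))

Rev : ForceFamily n K → ForceFamily n K
Rev 𝓕 k v = comprehension (λ u → v ∈? 𝓕 (opposite k) u)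

-- D⁽ᵗ⁾ and its union D^[ t ] over 0, …, t.
mutual
  D : Graph n → Subset n → Forces n → ℕ → Subset n
  D G B F zero    = B
  D G B F (suc t) = comprehension
    (λ w → any? (λ v → w ∈? F v ×-dec validForce? G (D^[ t ] G B F) v w))

  D^[_] : ℕ → Graph n → Subset n → Forces n → Subset n
  D^[ zero  ] G B F = D G B F zero
  D^[ suc t ] G B F = D^[ t ] G B F ∪ D G B F (suc t)

-- IsPropagationTime G B 𝓕 t says that pt(G, 𝓕), computed from the initial
-- set B, is defined and equal to t. It is a relation because the least t₀
-- need not exist for an arbitrary family 𝓕.
IsPropagationTime : Graph n → Subset n → ForceFamily n K → ℕ → Set
IsPropagationTime G B 𝓕 t =
  Full t × (∀ s → Full s → t ℕ.≤ s)
  where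
  Full : ℕ → Set
  Full s = D^[ s ] G B (underlying 𝓕) ≡ ⊤

{-# OPTIONS --safe #-}

-- In Rev 𝓕, the vertices blue before step k are those performing no force of
-- 𝓕 at or before step K − k + 1, which makes the reversed forces valid. A
-- relaxed chronology makes its initial set zero forcing because a set
-- containing B that admits no force is everything. For the propagation time,
-- if the sets D⁽ᵗ⁾ cover G after s steps, then they form a relaxed chronology
-- of length s with the same forces; as propagation is at least as fast as any
-- chronology, its reversal shows that the reversed forces also need at most s
-- steps. Equality follows since reversing twice restores B and the forces.
module Submission where

open import Defs
open import Data.Bool using (true)
open import Data.Bool.Properties using () renaming (_≟_ to _≟ᵇ_)
open import Data.Fin using (Fin; zero; suc; toℕ; fromℕ; inject₁; opposite; _≤_; _<_)
open import Data.Fin.Induction using (<-weakInduction)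
open import Data.Fin.Properties
  using (any?; _≤?_; toℕ-injective; toℕ-inject₁; toℕ-fromℕ; toℕ<n; ≤fromℕ; opposite-prop;
         opposite-involutive; <-cmp)
open import Data.Fin.Subset using (Subset; _∈_; _∉_; _⊆_; _⊂_; _∪_; ⁅_⁆; ⊤)
open import Data.Fin.Subset.Induction using (Acc; acc; ⊃-wellFounded)
open import Data.Fin.Subset.Properties
  using (_∈?_; ∈⊤; ⊆⊤; ⊆-antisym; p⊆p∪q; q⊆p∪q; x∈p∪q⁻; x∈⁅x⁆)
open import Data.Nat as ℕ using (ℕ; zero; suc; z≤n; s≤s)
open import Data.Nat.Induction using (<-rec)
import Data.Nat.Properties as ℕ
open import Data.Product using (∃; ∃₂; _×_; _,_; proj₁; proj₂)
open import Data.Sum using (_⊎_; inj₁; inj₂)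
open import Data.Vec.Properties using (≡-dec; []=⇒lookup; lookup⇒[]=; lookup∘tabulate)
open import Function using (_∘_; _⇔_; mk⇔; Equivalence)
open import Relation.Binary.Construct.Closure.ReflexiveTransitive using (ε; _◅_)
open import Relation.Binary.Definitions using (tri<; tri≈; tri>)
open import Relation.Binary.PropositionalEquality
  using (_≡_; refl; trans; cong; subst; subst₂) renaming (sym to ≡-sym)
open import Relation.Nullary using (¬_; yes; no; does; ¬?; contradiction; Dec; _because_; ofʸ)
open import Relation.Nullary.Decidable using (dec-true; decidable-stable; _×-dec_)
open import Relation.Unary using (Decidable)

open Equivalence using (to; from)
open IsRelaxedChronology

private
  variable
    n K : ℕ
    G : Graph n
    B X Y : Subset n
    F : Forces n
    𝓕 : ForceFamily n K
    u v : Fin n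

-- Membership in the sets computed from a family of forces.

∈-comprehension : {P : Fin n → Set} (P? : Decidable P) → u ∈ comprehension P? ⇔ P u
∈-comprehension {u = u} P? = mk⇔
  (λ u∈ → does-true (P? u) (trans (≡-sym (lookup∘tabulate _ u)) ([]=⇒lookup u∈)))
  (λ p → lookup⇒[]= u _ (trans (lookup∘tabulate _ u) (dec-true (P? u) p)))
  where
  does-true : {A : Set} (a? : Dec A) → does a? ≡ true → A
  does-true (true because ofʸ a) _ = a

∈E : {k : Fin K} → u ∈ E B 𝓕 (suc k) ⇔ ∃ λ v → u ∈ 𝓕 k v
∈E {𝓕 = 𝓕} {k = k} = ∈-comprehension (λ u → any? (λ v → u ∈? 𝓕 k v))

∈E^ : (k : Fin (suc K)) → u ∈ E^[ k ] B 𝓕 ⇔ ∃ λ j → j ≤ k × u ∈ E B 𝓕 j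
∈E^ {B = B} {𝓕 = 𝓕} k =
  ∈-comprehension (λ u → any? (λ j → j ≤? k ×-dec u ∈? E B 𝓕 j))

∈underlying : (𝓕 : ForceFamily n K) → u ∈ underlying 𝓕 v ⇔ ∃ λ k → u ∈ 𝓕 k v
∈underlying {v = v} 𝓕 = ∈-comprehension (λ u → any? (λ k → u ∈? 𝓕 k v))

∈Term : (𝓕 : ForceFamily n K) → v ∈ Term 𝓕 ⇔ (¬ ∃ λ u → u ∈ underlying 𝓕 v)
∈Term 𝓕 = ∈-comprehension (λ v → ¬? (any? (λ u → u ∈? underlying 𝓕 v)))

∈Rev : (𝓕 : ForceFamily n K) (k : Fin K) → u ∈ Rev 𝓕 k v ⇔ v ∈ 𝓕 (opposite k) u
∈Rev {v = v} 𝓕 k = ∈-comprehension (λ u → v ∈? 𝓕 (opposite k) u)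

reverse-force : (𝓕 : ForceFamily n K) (k : Fin K) → u ∈ 𝓕 k v → v ∈ Rev 𝓕 (opposite k) u
reverse-force {u = u} {v = v} 𝓕 k u∈ =
  from (∈Rev 𝓕 (opposite k)) (subst (λ j → u ∈ 𝓕 j v) (≡-sym (opposite-involutive k)) u∈)

∈underlying-Rev : (𝓕 : ForceFamily n K) → u ∈ underlying (Rev 𝓕) v ⇔ v ∈ underlying 𝓕 u
∈underlying-Rev {u = u} {v = v} 𝓕 = mk⇔
  (λ v→u → let k , u∈ = to (∈underlying {v = v} (Rev 𝓕)) v→u in
           from (∈underlying 𝓕) (opposite k , to (∈Rev {v = v} 𝓕 k) u∈))
  (λ u→v → let k , v∈ = to (∈underlying {v = u} 𝓕) u→v in
           from (∈underlying {v = v} (Rev 𝓕)) (opposite k , reverse-force 𝓕 k v∈))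

∈D : {t : ℕ} → u ∈ D G B F (suc t) ⇔ ∃ λ v → u ∈ F v × ValidForce G (D^[ t ] G B F) v u
∈D {G = G} {B = B} {F = F} {t = t} = ∈-comprehension
  (λ w → any? (λ v → w ∈? F v ×-dec validForce? G (D^[ t ] G B F) v w))

-- Monotonicity of forcing and of the blue sets.

ValidForce-mono : X ⊆ Y → u ∉ Y → ValidForce G X v u → ValidForce G Y v u
ValidForce-mono X⊆Y u∉Y (v∈X , _ , vu , only) =
  X⊆Y v∈X , u∉Y , vu , λ w vw w∉Y → only w vw (w∉Y ∘ X⊆Y)

⊂-insert : u ∉ X → X ⊂ X ∪ ⁅ u ⁆
⊂-insert {u = u} {X = X} u∉X = p⊆p∪q ⁅ u ⁆ , (u , q⊆p∪q X ⁅ u ⁆ (x∈⁅x⁆ u) , u∉X)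

opposite-anti-< : {i j : Fin K} → i < j → opposite j < opposite i
opposite-anti-< {i = i} {j} i<j =
  subst₂ ℕ._<_ (≡-sym (opposite-prop j)) (≡-sym (opposite-prop i))
    (ℕ.∸-monoʳ-< (s≤s i<j) (toℕ<n j))

E^-mono : (i j : Fin (suc K)) → i ≤ j → E^[ i ] B 𝓕 ⊆ E^[ j ] B 𝓕
E^-mono i j i≤j u∈ with to (∈E^ i) u∈
... | l , l≤i , u∈E = from (∈E^ j) (l , ℕ.≤-trans l≤i i≤j , u∈E)

inject₁-mono : {i j : Fin K} → i ≤ j → inject₁ i ≤ inject₁ j
inject₁-mono {i = i} {j} = subst₂ ℕ._≤_ (≡-sym (toℕ-inject₁ i)) (≡-sym (toℕ-inject₁ j))

-- A vertex forced in step `i` belongs to the set with index `suc i`, while the blue set before step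
-- `j` has index `inject₁ j`.
suc≤inject₁ : {i j : Fin K} → i < j → suc i ≤ inject₁ j
suc≤inject₁ {i = i} {j} = subst (suc (toℕ i) ℕ.≤_) (≡-sym (toℕ-inject₁ j))

initial⊆E^ : (k : Fin (suc K)) → B ⊆ E^[ k ] B 𝓕
initial⊆E^ k u∈B = from (∈E^ k) (zero , z≤n , u∈B)

E^-zero : (𝓕 : ForceFamily n K) → E^[ zero ] B 𝓕 ⊆ B
E^-zero {B = B} 𝓕 u∈ with to (∈E^ {B = B} {𝓕 = 𝓕} zero) u∈
... | zero , _ , u∈B = u∈B

-- Recasts the union defining `E^[_]` as a recursion, the form in which inductions over the steps
-- use it.
E^-suc : (k : Fin K) → u ∈ E^[ suc k ] B 𝓕 ⇔ (u ∈ E^[ inject₁ k ] B 𝓕 ⊎ ∃ λ v → u ∈ 𝓕 k v)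
E^-suc {u = u} {B = B} {𝓕 = 𝓕} k = mk⇔ split join
  where
  split : u ∈ E^[ suc k ] B 𝓕 → u ∈ E^[ inject₁ k ] B 𝓕 ⊎ ∃ λ v → u ∈ 𝓕 k v
  split u∈ with to (∈E^ (suc k)) u∈
  ... | j , j≤sk , u∈E with ℕ.m≤n⇒m<n∨m≡n j≤sk
  ...   | inj₁ (s≤s j≤k) =
            inj₁ (from (∈E^ (inject₁ k)) (j , subst (toℕ j ℕ.≤_) (≡-sym (toℕ-inject₁ k)) j≤k , u∈E))
  ...   | inj₂ j≡sk =
            inj₂ (to (∈E {B = B} {𝓕 = 𝓕}) (subst (λ l → u ∈ E B 𝓕 l) (toℕ-injective j≡sk) u∈E))
  join : u ∈ E^[ inject₁ k ] B 𝓕 ⊎ (∃ λ v → u ∈ 𝓕 k v) → u ∈ E^[ suc k ] B 𝓕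
  join (inj₁ u∈) = E^-mono (inject₁ k) (suc k)
    (subst (ℕ._≤ suc (toℕ k)) (≡-sym (toℕ-inject₁ k)) (ℕ.n≤1+n (toℕ k))) u∈
  join (inj₂ v→u) = from (∈E^ (suc k)) (suc k , ℕ.≤-refl , from (∈E {B = B} {𝓕 = 𝓕}) v→u)

-- Relaxed chronologies and their reversal.

module Chronology {n K} {G : Graph n} {B : Subset n} {𝓕 : ForceFamily n K}
                  (C : IsRelaxedChronology G B 𝓕) where

  white-before : ∀ {k u v} → u ∈ 𝓕 k v → u ∉ E^[ inject₁ k ] B 𝓕
  white-before u∈ = proj₁ (proj₂ (valid C _ _ _ u∈))

  blue-after : ∀ {i j u v} → u ∈ 𝓕 i v → i < j → u ∈ E^[ inject₁ j ] B 𝓕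
  blue-after {i} {j} u∈ i<j =
    E^-mono (suc i) (inject₁ j) (suc≤inject₁ i<j) (from (E^-suc i) (inj₂ (_ , u∈)))

  forced-once : ∀ {i j u v w} → u ∈ 𝓕 i v → u ∈ 𝓕 j w → i ≡ j
  forced-once {i} {j} u∈i u∈j with <-cmp i j
  ... | tri< i<j _ _ = contradiction (blue-after u∈i i<j) (white-before u∈j)
  ... | tri≈ _ i≡j _ = i≡j
  ... | tri> _ _ j<i = contradiction (blue-after u∈j j<i) (white-before u∈i)

  forcer-unique : ∀ {u v w} → u ∈ underlying 𝓕 v → u ∈ underlying 𝓕 w → v ≡ w
  forcer-unique v→u w→u with to (∈underlying 𝓕) v→u | to (∈underlying 𝓕) w→u
  ... | i , u∈i | j , u∈j with forced-once u∈i u∈j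
  ...   | refl = uniqueForcer C i _ _ _ u∈i u∈j

  initial-or-forced : ∀ u → u ∈ B ⊎ ∃₂ λ k v → u ∈ 𝓕 k v
  initial-or-forced u with to (∈E^ (fromℕ K)) (subst (u ∈_) (≡-sym (allBlue C)) ∈⊤)
  ... | zero  , _ , u∈B = inj₁ u∈B
  ... | suc k , _ , u∈E = inj₂ (k , to (∈E {B = B} {𝓕 = 𝓕}) u∈E)

  initial-unforced : ∀ {u v k} → u ∈ B → u ∉ 𝓕 k v
  initial-unforced {k = k} u∈B u∈ = white-before u∈ (initial⊆E^ (inject₁ k) u∈B)

  -- When `v` forces `u`, its only white neighbour is `u`. A vertex forced by `v` later is also
  -- white at that moment, so it is `u` again, which cannot be forced twice.
  forces-once : ∀ {i j v u w} → i < j → u ∈ 𝓕 i v → w ∉ 𝓕 j v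
  forces-once {i} {j} i<j u∈ w∈ = ℕ.<-irrefl (cong toℕ (forced-once u∈ u∈j)) i<j
    where
    w≡u = proj₂ (proj₂ (proj₂ (valid C i _ _ u∈))) _ (proj₁ (proj₂ (proj₂ (valid C j _ _ w∈))))
            (white-before w∈ ∘ E^-mono (inject₁ i) (inject₁ j) (inject₁-mono (ℕ.<⇒≤ i<j)))
    u∈j = subst (_∈ 𝓕 j _) w≡u w∈

  -- As long as the blue set lies inside `X`, a force of `𝓕` into a vertex outside `X` would be
  -- valid for `X` as well. Hence the chronology never leaves `X`.
  closed⇒⊤ : ∀ {X} → B ⊆ X → (∀ v u → ¬ ValidForce G X v u) → X ≡ ⊤
  closed⇒⊤ {X} B⊆X closed =
    ⊆-antisym ⊆⊤ (E^⊆X (fromℕ K) ∘ subst (_ ∈_) (≡-sym (allBlue C)))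
    where
    step : ∀ k → E^[ inject₁ k ] B 𝓕 ⊆ X → E^[ suc k ] B 𝓕 ⊆ X
    step k ih {u} u∈ with to (E^-suc k) u∈
    ... | inj₁ u∈E = ih u∈E
    ... | inj₂ (v , v→u) = decidable-stable (u ∈? X) λ u∉X →
          closed v u (ValidForce-mono {G = G} ih u∉X (valid C k v u v→u))
    E^⊆X : ∀ k → E^[ k ] B 𝓕 ⊆ X
    E^⊆X = <-weakInduction (λ k → E^[ k ] B 𝓕 ⊆ X) (λ u∈ → B⊆X (E^-zero 𝓕 u∈)) step

  -- Greedy forcing: any valid force is performed, in `𝓕` or not. Each one enlarges the blue set,
  -- and by `closed⇒⊤` the process can only stop at `⊤`.
  zeroForcing : IsZeroForcingSet G B
  zeroForcing = grow B (⊃-wellFounded B) (λ u∈B → u∈B)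
    where
    grow : ∀ X → Acc _ X → B ⊆ X → IsZeroForcingSet G X
    grow X (acc rec) B⊆X with any? (λ v → any? (λ u → validForce? G X v u))
    ... | no none =
          subst (IsZeroForcingSet G) (≡-sym (closed⇒⊤ B⊆X λ v u f → none (v , u , f))) ε
    ... | yes (v , u , f) =
          (v , u , f , refl) ◅
          grow (X ∪ ⁅ u ⁆) (rec (⊂-insert (proj₁ (proj₂ f)))) (p⊆p∪q ⁅ u ⁆ ∘ B⊆X)

  -- Propagation is never slower than the chronology: `E^[ k ]` lies in the union of the first `k`
  -- rounds. Leaving `F` general lets one chronology bound the propagation of any set containing its
  -- forces.
  D-full : (∀ k v u → u ∈ 𝓕 k v → u ∈ F v) → D^[ K ] G B F ≡ ⊤
  D-full {F = F} 𝓕⊆F = ⊆-antisym ⊆⊤ λ {u} u∈⊤ →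
    subst (λ t → u ∈ D^[ t ] G B F) (toℕ-fromℕ K)
      (E^⊆D^ (fromℕ K) (subst (u ∈_) (≡-sym (allBlue C)) u∈⊤))
    where
    step : ∀ k → E^[ inject₁ k ] B 𝓕 ⊆ D^[ toℕ k ] G B F →
           E^[ suc k ] B 𝓕 ⊆ D^[ suc (toℕ k) ] G B F
    -- Propagation may have reached `u` earlier, in which case the force into `u` is no longer valid
    -- there.
    step k ih {u} u∈ with u ∈? D^[ toℕ k ] G B F
    ... | yes u∈D = p⊆p∪q _ u∈D
    ... | no  u∉D with to (E^-suc k) u∈
    ...   | inj₁ u∈E = contradiction (ih u∈E) u∉D
    ...   | inj₂ (v , v→u) = q⊆p∪q (D^[ toℕ k ] G B F) _ (from (∈D {G = G} {B = B} {t = toℕ k})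
              (v , 𝓕⊆F k v u v→u , ValidForce-mono {G = G} ih u∉D (valid C k v u v→u)))
    E^⊆D^ : ∀ k → E^[ k ] B 𝓕 ⊆ D^[ toℕ k ] G B F
    E^⊆D^ = <-weakInduction (λ k → E^[ k ] B 𝓕 ⊆ D^[ toℕ k ] G B F) (E^-zero 𝓕) λ k ih →
      step k (subst (λ t → E^[ inject₁ k ] B 𝓕 ⊆ D^[ t ] G B F) (toℕ-inject₁ k) ih)

  -- A force by `w` in step `i` is undone in step `opposite i`. If `i` exceeds `opposite k`, that
  -- happens before step `k`; if `w` never forces, it is blue from the start.
  forces-or-blue : ∀ k w → w ∈ E^[ inject₁ k ] (Term 𝓕) (Rev 𝓕) ⊎
                           ∃₂ λ i x → i ≤ opposite k × x ∈ 𝓕 i w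
  forces-or-blue k w with any? (λ x → x ∈? underlying 𝓕 w)
  ... | no idle = inj₁ (initial⊆E^ (inject₁ k) (from (∈Term 𝓕) idle))
  ... | yes (x , w→x) with to (∈underlying 𝓕) w→x
  ...   | i , x∈ with i ≤? opposite k
  ...     | yes i≤ = inj₂ (i , x , i≤ , x∈)
  ...     | no  i≰ = inj₁ (E^-mono (suc (opposite i)) (inject₁ k) (suc≤inject₁ late)
              (from (E^-suc (opposite i)) (inj₂ (x , reverse-force 𝓕 i x∈))))
    where
    late : opposite i < k
    late = subst (opposite i <_) (opposite-involutive k) (opposite-anti-< (ℕ.≰⇒> i≰))

  reverse : IsRelaxedChronology G (Term 𝓕) (Rev 𝓕)
  reverse .valid k v u v→u = v-blue , u-white , sym G u~v , only
    where
    m = opposite k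
    u→v : v ∈ 𝓕 m u
    u→v = to (∈Rev 𝓕 k) v→u
    u~v = proj₁ (proj₂ (proj₂ (valid C m u v u→v)))
    v-white : ∀ {i} → i ≤ m → v ∉ E^[ inject₁ i ] B 𝓕
    v-white {i} i≤m = white-before u→v ∘ E^-mono (inject₁ i) (inject₁ m) (inject₁-mono i≤m)
    v-blue : v ∈ E^[ inject₁ k ] (Term 𝓕) (Rev 𝓕)
    v-blue with forces-or-blue k v
    ... | inj₁ v∈ = v∈
    -- To force in step `i`, `v` would have to be blue already, yet it stays white until it is
    -- forced in step `m`.
    ... | inj₂ (i , x , i≤m , x∈) = contradiction (proj₁ (valid C i v x x∈)) (v-white i≤m)
    u-white : u ∉ E^[ inject₁ k ] (Term 𝓕) (Rev 𝓕)
    u-white u∈ with to (∈E^ (inject₁ k)) u∈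
    ... | zero , _ , u∈T = to (∈Term 𝓕) u∈T (v , from (∈underlying 𝓕) (m , u→v))
    ... | suc j , j<k , u∈E with to (∈E {B = Term 𝓕} {𝓕 = Rev 𝓕}) u∈E
    -- Being blue too early would mean that `u` also forces `x` in step `opposite j`, which comes
    -- after `m`.
    ...   | x , x→u = forces-once m<oppj u→v (to (∈Rev {v = x} 𝓕 j) x→u)
      where
      m<oppj : m < opposite j
      m<oppj = opposite-anti-< (subst (suc (toℕ j) ℕ.≤_) (toℕ-inject₁ k) j<k)
    only : ∀ w → Adj G v w → w ∉ E^[ inject₁ k ] (Term 𝓕) (Rev 𝓕) → w ≡ u
    only w v~w w∉ with forces-or-blue k w
    ... | inj₁ w∈ = contradiction w∈ w∉
    -- In step `i` the vertex `v` is a white neighbour of `w`, so `w` forces `v` itself; the forcer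
    -- of `v` is unique.
    ... | inj₂ (i , x , i≤m , x∈)
        with proj₂ (proj₂ (proj₂ (valid C i w x x∈))) v (sym G v~w) (v-white i≤m)
    ...   | refl = forcer-unique (from (∈underlying 𝓕) (i , x∈)) (from (∈underlying 𝓕) (m , u→v))
  reverse .uniqueForcer k v₁ v₂ u v₁→u v₂→u =
    -- In `𝓕`, `u` has a single white neighbour at step `m`, so it cannot force two vertices there.
    ≡-sym (proj₂ (proj₂ (proj₂ (valid C m u v₁ u→v₁))) v₂
      (proj₁ (proj₂ (proj₂ (valid C m u v₂ u→v₂)))) (white-before u→v₂))
    where
    m = opposite k
    u→v₁ = to (∈Rev 𝓕 k) v₁→u
    u→v₂ = to (∈Rev 𝓕 k) v₂→u
  reverse .allBlue = ⊆-antisym ⊆⊤ λ {v} _ → blue v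
    where
    blue : ∀ v → v ∈ E^[ fromℕ K ] (Term 𝓕) (Rev 𝓕)
    blue v with any? (λ u → u ∈? underlying 𝓕 v)
    ... | no idle = initial⊆E^ (fromℕ K) (from (∈Term 𝓕) idle)
    ... | yes (u , v→u) with to (∈underlying 𝓕) v→u
    ...   | k , u∈ = E^-mono (suc (opposite k)) (fromℕ K) (≤fromℕ (suc (opposite k)))
            (from (E^-suc (opposite k)) (inj₂ (u , reverse-force 𝓕 k u∈)))

-- Propagation as a chronology.

open Chronology

-- The first `s` rounds of propagation recast as a family of forces, so that `reverse` applies to
-- them. Stage `k` acts on `D^[ k ]` and produces round `k + 1`.
stages : (G : Graph n) → Subset n → Forces n → (s : ℕ) → ForceFamily n s
stages G B F s k v =
  comprehension (λ u → u ∈? F v ×-dec validForce? G (D^[ toℕ k ] G B F) v u)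

module _ {n} (G : Graph n) (B : Subset n) (F : Forces n) where

  ∈stages : ∀ {s} (k : Fin s) {v u} →
            u ∈ stages G B F s k v ⇔ (u ∈ F v × ValidForce G (D^[ toℕ k ] G B F) v u)
  ∈stages k {v} = ∈-comprehension
    (λ u → u ∈? F v ×-dec validForce? G (D^[ toℕ k ] G B F) v u)

  E^-stages : ∀ {s} (k : Fin (suc s)) → E^[ k ] B (stages G B F s) ≡ D^[ toℕ k ] G B F
  E^-stages {s} = <-weakInduction _
    (⊆-antisym (E^-zero 𝓓) (initial⊆E^ {𝓕 = 𝓓} zero))
    λ k ih → step k (trans ih (cong (λ t → D^[ t ] G B F) (toℕ-inject₁ k)))
    where
    𝓓 = stages G B F s
    step : ∀ k → E^[ inject₁ k ] B 𝓓 ≡ D^[ toℕ k ] G B F →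
           E^[ suc k ] B 𝓓 ≡ D^[ suc (toℕ k) ] G B F
    step k ih = ⊆-antisym ⊆D ⊇D
      where
      ⊆D : E^[ suc k ] B 𝓓 ⊆ D^[ suc (toℕ k) ] G B F
      ⊆D u∈ with to (E^-suc k) u∈
      ... | inj₁ u∈E = p⊆p∪q _ (subst (_ ∈_) ih u∈E)
      ... | inj₂ (v , v→u) = q⊆p∪q (D^[ toℕ k ] G B F) _
              (from (∈D {G = G} {B = B} {t = toℕ k}) (v , to (∈stages k) v→u))
      ⊇D : D^[ suc (toℕ k) ] G B F ⊆ E^[ suc k ] B 𝓓
      ⊇D u∈ with x∈p∪q⁻ (D^[ toℕ k ] G B F) _ u∈
      ... | inj₁ u∈D = from (E^-suc k) (inj₁ (subst (_ ∈_) (≡-sym ih) u∈D))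
      ... | inj₂ u∈D with to (∈D {G = G} {B = B} {t = toℕ k}) u∈D
      ...   | v , v→u = from (E^-suc k) (inj₂ (v , from (∈stages k) v→u))

  stages-chronology : ∀ {s} → (∀ {u v w} → u ∈ F v → u ∈ F w → v ≡ w) →
    D^[ s ] G B F ≡ ⊤ → IsRelaxedChronology G B (stages G B F s)
  stages-chronology _ _ .valid k v u v→u =
    subst (λ X → ValidForce G X v u)
      (≡-sym (trans (E^-stages (inject₁ k)) (cong (λ t → D^[ t ] G B F) (toℕ-inject₁ k))))
      (proj₂ (to (∈stages k) v→u))
  stages-chronology F-injective _ .uniqueForcer k v₁ v₂ u v₁→u v₂→u =
    F-injective (proj₁ (to (∈stages k) v₁→u)) (proj₁ (to (∈stages k) v₂→u))
  stages-chronology {s} _ full .allBlue =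
    trans (E^-stages (fromℕ s)) (trans (cong (λ t → D^[ t ] G B F) (toℕ-fromℕ s)) full)

-- Termini and propagation times under reversal.

Term-cong : {K L : ℕ} {𝓕 : ForceFamily n K} {𝓖 : ForceFamily n L} →
  (∀ v → underlying 𝓕 v ≡ underlying 𝓖 v) → Term 𝓕 ≡ Term 𝓖
Term-cong {𝓕 = 𝓕} {𝓖} eq = ⊆-antisym
  (λ {v} v∈ → from (∈Term 𝓖) λ (u , u∈) → to (∈Term 𝓕) v∈ (u , subst (u ∈_) (≡-sym (eq v)) u∈))
  (λ {v} v∈ → from (∈Term 𝓕) λ (u , u∈) → to (∈Term 𝓖) v∈ (u , subst (u ∈_) (eq v) u∈))

-- A vertex forces in `Rev 𝓕` exactly when it is forced in `𝓕`, and the vertices never forced are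
-- those of `B`.
Term-Rev : {𝓕 : ForceFamily n K} → IsRelaxedChronology G B 𝓕 → Term (Rev 𝓕) ≡ B
Term-Rev {G = G} {B = B} {𝓕 = 𝓕} C = ⊆-antisym ⊆B ⊇B
  where
  ⊆B : Term (Rev 𝓕) ⊆ B
  ⊆B {u} u∈ with initial-or-forced C u
  ... | inj₁ u∈B = u∈B
  ... | inj₂ (k , v , v→u) = contradiction
          (v , from (∈underlying-Rev 𝓕) (from (∈underlying 𝓕) (k , v→u)))
          (to (∈Term (Rev 𝓕)) u∈)
  ⊇B : B ⊆ Term (Rev 𝓕)
  ⊇B u∈B = from (∈Term (Rev 𝓕)) λ (v , u→v) →
    let k , u∈ = to (∈underlying 𝓕) (to (∈underlying-Rev 𝓕) u→v) in initial-unforced C u∈B u∈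

-- No force is lost: the target of a force of `𝓕` lies outside `B`, so some stage forces it, and by
-- uniqueness of the forcer it does so by that same force.
underlying-stages : {𝓕 : ForceFamily n K} (s : ℕ) → IsRelaxedChronology G B 𝓕 →
  D^[ s ] G B (underlying 𝓕) ≡ ⊤ →
  ∀ v → underlying (stages G B (underlying 𝓕) s) v ≡ underlying 𝓕 v
underlying-stages {G = G} {B = B} {𝓕 = 𝓕} s C full v = ⊆-antisym
  (λ v→u → let k , u∈ = to (∈underlying 𝓓) v→u in proj₁ (to (∈stages G B (underlying 𝓕) k) u∈))
  performed
  where
  𝓓 = stages G B (underlying 𝓕) s
  performed : underlying 𝓕 v ⊆ underlying 𝓓 v
  performed {u} v→u
    with initial-or-forced (stages-chronology G B (underlying 𝓕) (forcer-unique C) full) u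
  ... | inj₁ u∈B = contradiction (proj₂ (to (∈underlying 𝓕) v→u)) (initial-unforced C u∈B)
  ... | inj₂ (k , w , w→u)
      with forcer-unique C v→u (proj₁ (to (∈stages G B (underlying 𝓕) k) w→u))
  ...   | refl = from (∈underlying 𝓓) (k , w→u)

-- The stages have the forces of `𝓕`, hence its terminus. Their reversal is a chronology of length
-- `s`, and `D-full` turns this length into a bound on propagation.
reverse-full : {𝓕 : ForceFamily n K} (s : ℕ) → IsRelaxedChronology G B 𝓕 →
  (∀ {u v} → u ∈ underlying 𝓕 v → v ∈ F u) →
  D^[ s ] G B (underlying 𝓕) ≡ ⊤ → D^[ s ] G (Term 𝓕) F ≡ ⊤
reverse-full {G = G} {B = B} {F = F} {𝓕 = 𝓕} s C flip full =
  subst (λ T → D^[ s ] G T F ≡ ⊤) (Term-cong {𝓕 = 𝓓} {𝓖 = 𝓕} (underlying-stages s C full))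
    (D-full (reverse C𝓓) λ k v u v→u →
      flip (proj₁ (to (∈stages G B (underlying 𝓕) (opposite k)) (to (∈Rev 𝓓 k) v→u))))
  where
  𝓓 = stages G B (underlying 𝓕) s
  C𝓓 : IsRelaxedChronology G B 𝓓
  C𝓓 = stages-chronology G B (underlying 𝓕) (forcer-unique C) full

least : {P : ℕ → Set} → (∀ m → Dec (P m)) → ∀ m → P m → ∃ λ t → P t × (∀ s → P s → t ℕ.≤ s)
least {P} P? = <-rec _ λ m rec Pm → search m rec Pm (ℕ.anyUpTo? P? m)
  where
  search : ∀ m → (∀ {k} → k ℕ.< m → P k → ∃ λ t → P t × (∀ s → P s → t ℕ.≤ s)) → P m →
           Dec (∃ λ k → k ℕ.< m × P k) → ∃ λ t → P t × (∀ s → P s → t ℕ.≤ s)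
  search m rec Pm (yes (k , k<m , Pk)) = rec k<m Pk
  search m rec Pm (no none) = m , Pm , λ s Ps → ℕ.≮⇒≥ λ s<m → none (s , s<m , Ps)

lemma4p3 : (n : ℕ) (G : Graph n) (B : Subset n) → IsZeroForcingSet G B →
    (K : ℕ) (𝓕 : ForceFamily n K) → IsRelaxedChronology G B 𝓕 →
    IsZeroForcingSet G (Term 𝓕)
    × IsRelaxedChronology G (Term 𝓕) (Rev 𝓕)
    × ∃ (λ t → IsPropagationTime G (Term 𝓕) (Rev 𝓕) t × IsPropagationTime G B 𝓕 t)
lemma4p3 n G B _ K 𝓕 C =
  zeroForcing (reverse C) , reverse C , t ,
  -- Both processes are complete after exactly the same numbers of rounds, so the least such number
  -- is common.
  (forth t full , λ s → minimal s ∘ back s) , full , minimal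
  where
  forth : ∀ s → D^[ s ] G B (underlying 𝓕) ≡ ⊤ → D^[ s ] G (Term 𝓕) (underlying (Rev 𝓕)) ≡ ⊤
  forth s = reverse-full s C (from (∈underlying-Rev 𝓕))
  back : ∀ s → D^[ s ] G (Term 𝓕) (underlying (Rev 𝓕)) ≡ ⊤ → D^[ s ] G B (underlying 𝓕) ≡ ⊤
  -- Only the starting set of the double reversal has to be identified with `B`; its forces enter
  -- through the parameter `F` of `reverse-full`.
  back s full′ = subst (λ T → D^[ s ] G T (underlying 𝓕) ≡ ⊤) (Term-Rev C)
    (reverse-full s (reverse C) (to (∈underlying-Rev 𝓕)) full′)
  -- The search for the least time starts from `K`, since `𝓕` itself takes `K` steps.
  pt : ∃ λ t → D^[ t ] G B (underlying 𝓕) ≡ ⊤ × (∀ s → D^[ s ] G B (underlying 𝓕) ≡ ⊤ → t ℕ.≤ s)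
  pt = least (λ s → ≡-dec _≟ᵇ_ (D^[ s ] G B (underlying 𝓕)) ⊤) K
         (D-full C λ k v u u∈ → from (∈underlying 𝓕) (k , u∈))
  t = proj₁ pt
  full = proj₁ (proj₂ pt)
  minimal = proj₂ (proj₂ pt)
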